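{- Let $n\ge 1$ and consider labeled chip-firing on the infinite binary tree (with a self-loop at the root) in which $2^n-1$ chips labeled $1,2,\dots,2^n-1$ are initially placed at the root. Then every terminal (stable) configuration reachable from this initial configuration has exactly one chip at each node of levels $1,\dots,n$ (i.e. at each node $1,2,\dots,2^n-1$) and no chips elsewhere. Moreover, for every node $i$ on a level $k$ with $1\le k\le n-1$, in such a terminal configuration the chip at node $2^{\,n-k}i$ is the smallest chip among all chips in the subtree rooted at $i$, and the chip at node $2^{\,n-k}(i+1)-1$ is the largest chip among all chips in the subtree rooted at $i$.
   Context: The infinite binary tree has nodes labeled by positive integers: node $1$ is the root, and node $i$ has left child $2i$, right child $2i+1$, and (for $i>1$) parent $\lfloor i/2\rfloor$. A self-loop is added at the root, so every node has exactly three incident edge-ends. The level of node $i$ is $\lfloor \log_2 i\rfloor+1$ (the root is on level $1$). The subtree rooted at $i$ consists of $i$ and all its descendants. Labeled chip-firing: chips carry distinct integer labels; a node holding at least $3$ chips may fire by choosing any $3$ of its chips and sending the smallest to its left child, the largest to its right child, and the middle one to its parent (if the root fires, the middle chip stays at the root via the self-loop). A configuration is terminal (stable) if every node holds at most $2$ chips. For a node $i$ on level $k<n$, the node $2^{n-k}i$ is its straight left descendant on level $n$ and $2^{n-k}(i+1)-1$ is its straight right descendant on level $n$. -}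

module Defs where

open import Data.Nat using (ℕ; zero; suc; _+_; _*_; _∸_; _^_; _≤_; _<_; _≡ᵇ_)
open import Data.Nat.DivMod using (_/_)
open import Data.Bool using (if_then_else_)
open import Data.List using (List; map; filter; length; upTo)
open import Data.Product using (∃; _×_; _,_)
open import Relation.Binary.PropositionalEquality using (_≡_)
open import Relation.Binary.Construct.Closure.ReflexiveTransitive using (Star)
open import Data.Nat.Properties using (_≟_)

-- Nodes of the infinite binary tree are positive integers; node 1 is the root.
-- The parent via the edge used by firing: the root's "parent" is itself (self-loop).
parent : ℕ → ℕ
parent 1 = 1
parent v = v / 2

-- Chips carry the distinct labels 1,…,N.  A configuration is a position map:
-- pos x is the node holding chip x (only the values on labels 1..N matter).
Config : Set
Config = ℕ → ℕ

labels : ℕ → List ℕ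
labels N = map suc (upTo N)

chipsAt : ℕ → Config → ℕ → List ℕ
chipsAt N p v = filter (λ x → p x ≟ v) (labels N)

fire : Config → ℕ → ℕ → ℕ → ℕ → Config
fire p v a b c x =
  if x ≡ᵇ a then 2 * v
  else if x ≡ᵇ b then parent v
  else if x ≡ᵇ c then suc (2 * v)
  else p x

-- one firing move: node v holds three chips a < b < c (labels in 1..N);
-- smallest goes to the left child 2v, largest to the right child 2v+1,
-- middle to the parent (stays at the root if v = 1).
data Step (N : ℕ) : Config → Config → Set where
  step : ∀ {p} v a b c →
         1 ≤ a → a < b → b < c → c ≤ N →
         p a ≡ v → p b ≡ v → p c ≡ v →
         Step N p (fire p v a b c)

Reachable : ℕ → Config → Config → Set
Reachable N = Star (Step N)

Terminal : ℕ → Config → Set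
Terminal N p = ∀ v → length (chipsAt N p v) ≤ 2

initial : Config
initial _ = 1

data InSubtree (i : ℕ) : ℕ → Set where
  here  : InSubtree i i
  left  : ∀ {j} → InSubtree i j → InSubtree i (2 * j)
  right : ∀ {j} → InSubtree i j → InSubtree i (suc (2 * j))

{-# OPTIONS --safe #-}
module Submission where

-- The numbers of firings per node (the odometer) of a stabilizing run determine the final chip
-- counts. A maximum principle shows that the odometer is the same for all stabilizing runs; it is
-- the one that leaves a single chip at each of the first n levels.
--
-- For the labels, let D v be the number of firings of v still to come and h v the height of v above
-- level n. Since a firing node needs three chips, D is interlocked along the edges, and during its
-- last h v firings v holds exactly three chips, so all of them are fired. The minimum of the
-- subtree of a node i never leaves it, always moves left, and satisfies h ≤ D at its position; hence
-- it ends on level n. If i is a right child, a chip entering after the last h i firings of i began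
-- was compared at the parent of i with a middle chip that i had just sent up, so it is no new
-- minimum. If i is a left child, its minimum is that of its parent. Maxima are treated by reflection.

open import Defs
open import Data.Bool using (true; false; if_then_else_)
open import Data.Bool.Properties using (T-≡)
open import Data.Empty using (⊥-elim)
open import Data.List using (List; []; _∷_; length; filter; upTo)
open import Data.List.Membership.Propositional using (_∈_)
open import Data.List.Membership.Propositional.Properties using (∈-map⁺; ∈-upTo⁺)
open import Data.List.Properties using (length-map; length-upTo)
open import Data.List.Relation.Unary.All as All using (All; []; _∷_)
open import Data.List.Relation.Unary.AllPairs using ([]; _∷_)
open import Data.List.Relation.Unary.Any using (here; there)
open import Data.List.Relation.Unary.Unique.Propositional using (Unique)
open import Data.List.Relation.Unary.Unique.Propositional.Properties using (upTo⁺; map⁺)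
open import Data.Nat using (ℕ; zero; suc; pred; _+_; _*_; _∸_; _^_; _≤_; _<_; _>_; _≡ᵇ_; _⊔_; z≤n; s≤s; >-nonZero; ⌊_/2⌋)
open import Data.Nat.DivMod using (_/_; _%_; m≡m%n+[m/n]*n; m%n<n; m*n/n≡m; +-distrib-/-∣ʳ; m≥n⇒m/n>0; m/n<m)
open import Data.Nat.Divisibility using (divides-refl)
open import Data.Nat.Induction using (<-rec)
open import Data.Nat.Logarithm using (⌊log₂_⌋; ⌊log₂⌊n/2⌋⌋≡⌊log₂n⌋∸1; ⌊log₂[2*b]⌋≡1+⌊log₂b⌋; ⌊log₂⌋-mono-≤)
open import Data.Nat.Properties
open import Data.Nat.Tactic.RingSolver using (solve-∀)
open import Data.Product using (∃; ∃₂; _×_; _,_; proj₁; proj₂)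
open import Data.Sum as Sum using (_⊎_; inj₁; inj₂; [_,_]′)
open import Function using (_∘_; flip; id; Equivalence)
open import Relation.Binary.Construct.Closure.ReflexiveTransitive using (ε; _◅_)
open import Relation.Binary.PropositionalEquality using (_≡_; _≢_; refl; sym; trans; cong; cong₂; subst; subst₂; module ≡-Reasoning)
open import Relation.Nullary using (¬_; yes; no)

-- The binary tree

left≥2 : ∀ {v} → 1 ≤ v → 2 ≤ 2 * v
left≥2 1≤v = *-monoʳ-≤ 2 1≤v

right≥2 : ∀ {v} → 1 ≤ v → 2 ≤ suc (2 * v)
right≥2 1≤v = m≤n⇒m≤1+n (left≥2 1≤v)

parent-half : ∀ {v} → 2 ≤ v → parent v ≡ v / 2
parent-half {suc zero}    (s≤s ())
parent-half {suc (suc v)} _ = refl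

parent-left : ∀ {v} → 1 ≤ v → parent (2 * v) ≡ v
parent-left {v} 1≤v = begin
  parent (2 * v)  ≡⟨ parent-half (left≥2 1≤v) ⟩
  2 * v / 2       ≡⟨ cong (_/ 2) (*-comm 2 v) ⟩
  v * 2 / 2       ≡⟨ m*n/n≡m v 2 ⟩
  v               ∎
  where open ≡-Reasoning

parent-right : ∀ {v} → 1 ≤ v → parent (suc (2 * v)) ≡ v
parent-right {v} 1≤v = begin
  parent (suc (2 * v))  ≡⟨ parent-half (right≥2 1≤v) ⟩
  suc (2 * v) / 2       ≡⟨ cong (λ z → suc z / 2) (*-comm 2 v) ⟩
  (1 + v * 2) / 2       ≡⟨ +-distrib-/-∣ʳ 1 {d = 2} (divides-refl v) ⟩
  v * 2 / 2             ≡⟨ m*n/n≡m v 2 ⟩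
  v                     ∎
  where open ≡-Reasoning

left-or-right : ∀ {v} → 2 ≤ v → v ≡ 2 * parent v ⊎ v ≡ suc (2 * parent v)
left-or-right {v} 2≤v rewrite parent-half 2≤v with v % 2 | m%n<n v 2 | m≡m%n+[m/n]*n v 2
... | 0 | _ | eq = inj₁ (trans eq (*-comm (v / 2) 2))
... | 1 | _ | eq = inj₂ (trans eq (cong suc (*-comm (v / 2) 2)))
... | suc (suc _) | s≤s (s≤s ()) | _

parent≥1 : ∀ {v} → 1 ≤ v → 1 ≤ parent v
parent≥1 {suc zero}    _ = s≤s z≤n
parent≥1 {suc (suc v)} _ = m≥n⇒m/n>0 {suc (suc v)} {2} (s≤s (s≤s z≤n))

parent< : ∀ {v} → 2 ≤ v → parent v < v
parent< {suc zero}    (s≤s ())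
parent< {suc (suc v)} _ = m/n<m (suc (suc v)) 2 (s≤s (s≤s z≤n))

-- The level of a node is `suc (depth v)`.
depth : ℕ → ℕ
depth v = ⌊log₂ v ⌋

depth-left : ∀ {v} → 1 ≤ v → depth (2 * v) ≡ suc (depth v)
depth-left {v} 1≤v = ⌊log₂[2*b]⌋≡1+⌊log₂b⌋ v {{>-nonZero 1≤v}}

depth-right : ∀ {v} → 1 ≤ v → depth (suc (2 * v)) ≡ suc (depth v)
depth-right {v} 1≤v = begin
  depth (suc (2 * v))               ≡⟨ m+[n∸m]≡n 1≤d ⟨
  suc (depth (suc (2 * v)) ∸ 1)     ≡⟨ cong suc (⌊log₂⌊n/2⌋⌋≡⌊log₂n⌋∸1 (suc (2 * v))) ⟨
  suc (depth ⌊ suc (2 * v) /2⌋)     ≡⟨ cong (suc ∘ depth) (half v) ⟩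
  suc (depth v)                     ∎
  where
  open ≡-Reasoning
  1≤d : 1 ≤ depth (suc (2 * v))
  1≤d = ≤-trans (subst (1 ≤_) (sym (depth-left 1≤v)) (s≤s z≤n)) (⌊log₂⌋-mono-≤ (n≤1+n (2 * v)))
  half : ∀ k → ⌊ suc (2 * k) /2⌋ ≡ k
  half zero = refl
  half (suc k) rewrite +-suc k (k + 0) = cong suc (half k)

depth-parent : ∀ {v} → 2 ≤ v → depth v ≡ suc (depth (parent v))
depth-parent {v} 2≤v with left-or-right 2≤v | parent≥1 (<⇒≤ 2≤v)
... | inj₁ eq | 1≤p = trans (cong depth eq) (depth-left 1≤p)
... | inj₂ eq | 1≤p = trans (cong depth eq) (depth-right 1≤p)

node-rec : (P : ℕ → Set) → P 1 → (∀ {v} → 2 ≤ v → P (parent v) → P v) → ∀ {v} → 1 ≤ v → P v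
node-rec P base extend {v} = <-rec (λ v → 1 ≤ v → P v) go v
  where
  go : ∀ v → (∀ {w} → w < v → 1 ≤ w → P w) → 1 ≤ v → P v
  go (suc zero)    rec _ = base
  go (suc (suc v)) rec _ = extend (s≤s (s≤s z≤n)) (rec (parent< (s≤s (s≤s z≤n))) (parent≥1 {suc (suc v)} (s≤s z≤n)))

2^depth≤ : ∀ {v} → 1 ≤ v → 2 ^ depth v ≤ v
2^depth≤ = node-rec (λ v → 2 ^ depth v ≤ v) ≤-refl extend
  where
  extend : ∀ {v} → 2 ≤ v → 2 ^ depth (parent v) ≤ parent v → 2 ^ depth v ≤ v
  extend {v} 2≤v ih rewrite depth-parent 2≤v with left-or-right 2≤v
  ... | inj₁ eq = ≤-trans (*-monoʳ-≤ 2 ih) (≤-reflexive (sym eq))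
  ... | inj₂ eq = ≤-trans (*-monoʳ-≤ 2 ih) (≤-trans (n≤1+n _) (≤-reflexive (sym eq)))

<2^1+depth : ∀ {v} → 1 ≤ v → v < 2 ^ suc (depth v)
<2^1+depth = node-rec (λ v → v < 2 ^ suc (depth v)) ≤-refl extend
  where
  extend : ∀ {v} → 2 ≤ v → parent v < 2 ^ suc (depth (parent v)) → v < 2 ^ suc (depth v)
  extend {v} 2≤v ih rewrite depth-parent 2≤v = begin-strict
    v                          ≤⟨ [ (λ eq → ≤-trans (≤-reflexive eq) (n≤1+n _)) , ≤-reflexive ]′ (left-or-right 2≤v) ⟩
    suc (2 * parent v)         <⟨ ≤-refl ⟩
    2 + 2 * parent v           ≡⟨ *-suc 2 (parent v) ⟨
    2 * suc (parent v)         ≤⟨ *-monoʳ-≤ 2 ih ⟩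
    2 ^ suc (suc (depth (parent v))) ∎
    where open ≤-Reasoning

2^-cancel-< : ∀ {a b} → 2 ^ a < 2 ^ b → a < b
2^-cancel-< {a} {b} lt = ≰⇒> λ b≤a → <⇒≱ lt (^-monoʳ-≤ 2 b≤a)

depth<⇔<2^ : ∀ {v k} → 1 ≤ v → (depth v < k → v < 2 ^ k) × (v < 2 ^ k → depth v < k)
depth<⇔<2^ 1≤v = (λ d<k → <-≤-trans (<2^1+depth 1≤v) (^-monoʳ-≤ 2 d<k))
               , (λ v<2^k → 2^-cancel-< (≤-<-trans (2^depth≤ 1≤v) v<2^k))

subtree-≥ : ∀ {i j} → InSubtree i j → i ≤ j
subtree-≥ here = ≤-refl
subtree-≥ (left s) = ≤-trans (subtree-≥ s) (m≤m+n _ _)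
subtree-≥ (right s) = ≤-trans (subtree-≥ s) (m≤n⇒m≤1+n (m≤m+n _ _))

parent∉subtree : ∀ {i} → 2 ≤ i → ¬ InSubtree i (parent i)
parent∉subtree 2≤i s = <⇒≱ (parent< 2≤i) (subtree-≥ s)

subtree-parent : ∀ {i j} → 1 ≤ i → InSubtree i j → j ≡ i ⊎ InSubtree i (parent j)
subtree-parent 1≤i here = inj₁ refl
subtree-parent 1≤i (left s) = inj₂ (subst (InSubtree _) (sym (parent-left (≤-trans 1≤i (subtree-≥ s)))) s)
subtree-parent 1≤i (right s) = inj₂ (subst (InSubtree _) (sym (parent-right (≤-trans 1≤i (subtree-≥ s)))) s)

parent-subtree : ∀ {i v} → 1 ≤ v → InSubtree i (parent v) → InSubtree i v
parent-subtree {i} {suc zero} _ s = s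
parent-subtree {i} {suc (suc v)} _ s with left-or-right {suc (suc v)} (s≤s (s≤s z≤n))
... | inj₁ eq = subst (InSubtree i) (sym eq) (left s)
... | inj₂ eq = subst (InSubtree i) (sym eq) (right s)

subtree-trans : ∀ {i j k} → InSubtree i j → InSubtree j k → InSubtree i k
subtree-trans s here = s
subtree-trans s (left t) = left (subtree-trans s t)
subtree-trans s (right t) = right (subtree-trans s t)

-- Counting chips

-- The Kronecker delta; `ind v` is also the odometer of a single firing of `v`.
ind : ℕ → ℕ → ℕ
ind v w = if v ≡ᵇ w then 1 else 0

≡ᵇ-refl : ∀ v → (v ≡ᵇ v) ≡ true
≡ᵇ-refl zero = refl
≡ᵇ-refl (suc v) = ≡ᵇ-refl v

≡ᵇ-≢ : ∀ {v w} → v ≢ w → (v ≡ᵇ w) ≡ false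
≡ᵇ-≢ {v} {w} v≢w with v ≡ᵇ w in eq
... | false = refl
... | true = ⊥-elim (v≢w (≡ᵇ⇒≡ v w (Equivalence.from T-≡ eq)))

ind-refl : ∀ v → ind v v ≡ 1
ind-refl v rewrite ≡ᵇ-refl v = refl

ind-≢ : ∀ {v w} → v ≢ w → ind v w ≡ 0
ind-≢ v≢w rewrite ≡ᵇ-≢ v≢w = refl

ind-sym : ∀ v w → ind v w ≡ ind w v
ind-sym zero zero = refl
ind-sym zero (suc w) = refl
ind-sym (suc v) zero = refl
ind-sym (suc v) (suc w) = ind-sym v w

-- The sum over the three neighbours. As `parent 1` is `1`, the loop makes the root its own
-- neighbour; `around u v` minus `3 * u v` is the graph Laplacian of `u`.
around : (ℕ → ℕ) → ℕ → ℕ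
around u v = u (parent v) + u (2 * v) + u (suc (2 * v))

ind-parent : ∀ {v w} → 2 ≤ v → 1 ≤ w → ind (parent v) w ≡ ind (2 * w) v + ind (suc (2 * w)) v
ind-parent {v} {w} 2≤v 1≤w with parent v ≟ w
... | no ≢w rewrite ind-≢ ≢w
      | ind-≢ {2 * w} {v} (λ eq → ≢w (trans (cong parent (sym eq)) (parent-left 1≤w)))
      | ind-≢ {suc (2 * w)} {v} (λ eq → ≢w (trans (cong parent (sym eq)) (parent-right 1≤w))) = refl
... | yes refl with left-or-right 2≤v
...   | inj₁ eq rewrite ind-refl (parent v) | sym eq | ind-refl v | ind-≢ {suc v} {v} 1+n≢n = refl
...   | inj₂ eq rewrite ind-refl (parent v) | sym eq | ind-refl v | ind-≢ {2 * parent v} {v} (λ eq′ → 1+n≢n (trans (sym eq) (sym eq′))) = refl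

-- Adjacency is symmetric, loop included: the chips that a firing of `v` sends to `w` are counted
-- from the end `v` on the left and from the end `w` on the right.
edge-sym : ∀ {v w} → 1 ≤ v → 1 ≤ w →
  ind (parent v) w + ind (2 * v) w + ind (suc (2 * v)) w ≡ around (ind v) w
edge-sym {suc zero} {suc zero} _ _ = refl
edge-sym {suc zero} {w@(suc (suc _))} _ _ = begin
  ind 2 w + ind 3 w     ≡⟨ ind-parent {w} {1} (s≤s (s≤s z≤n)) (s≤s z≤n) ⟨
  ind (parent w) 1      ≡⟨ ind-sym (parent w) 1 ⟩
  ind 1 (parent w)      ≡⟨ +-identityʳ _ ⟨
  ind 1 (parent w) + 0  ≡⟨ +-identityʳ _ ⟨
  ind 1 (parent w) + 0 + 0 ∎
  where open ≡-Reasoning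
edge-sym {v@(suc (suc _))} {suc zero} _ _ = begin
  ind (parent v) 1 + 0 + 0  ≡⟨ +-identityʳ _ ⟩
  ind (parent v) 1 + 0      ≡⟨ +-identityʳ _ ⟩
  ind (parent v) 1          ≡⟨ ind-parent {v} {1} (s≤s (s≤s z≤n)) (s≤s z≤n) ⟩
  ind 2 v + ind 3 v         ≡⟨ cong₂ _+_ (ind-sym 2 v) (ind-sym 3 v) ⟩
  ind v 2 + ind v 3         ∎
  where open ≡-Reasoning
edge-sym {v@(suc (suc _))} {w@(suc (suc _))} 1≤v 1≤w
  rewrite ind-parent {v} {w} (s≤s (s≤s z≤n)) 1≤w | ind-sym v (parent w)
        | ind-parent {w} {v} (s≤s (s≤s z≤n)) 1≤v | ind-sym v (2 * w) | ind-sym v (suc (2 * w))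
  = swap (ind (2 * w) v) (ind (suc (2 * w)) v) (ind (2 * v) w) (ind (suc (2 * v)) w)
  where
  swap : ∀ a b c d → a + b + c + d ≡ c + d + a + b
  swap = solve-∀

count : Config → ℕ → List ℕ → ℕ
count p w [] = 0
count p w (x ∷ xs) = ind (p x) w + count p w xs

length-filter : ∀ p w xs → length (filter (λ x → p x ≟ w) xs) ≡ count p w xs
length-filter p w [] = refl
length-filter p w (x ∷ xs) with p x ≡ᵇ w
... | true = cong suc (length-filter p w xs)
... | false = length-filter p w xs

Chip : ℕ → ℕ → Set
Chip N x = 1 ≤ x × x ≤ N

labels-unique : ∀ N → Unique (labels N)
labels-unique N = map⁺ suc-injective (upTo⁺ N)

chip∈labels : ∀ {N x} → Chip N x → x ∈ labels N
chip∈labels {N} {suc x} (_ , x<N) = ∈-map⁺ suc (∈-upTo⁺ x<N)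

-- By definition `fire p v a b c` is three such moves, of `c` first, then `b`, then `a`.
move : Config → ℕ → ℕ → Config
move p a t x = if x ≡ᵇ a then t else p x

move-at : ∀ p a t → move p a t a ≡ t
move-at p a t rewrite ≡ᵇ-refl a = refl

move-off : ∀ p t {a x} → x ≢ a → move p a t x ≡ p x
move-off p t x≢a rewrite ≡ᵇ-≢ x≢a = refl

count-move-∉ : ∀ p t w {a xs} → All (a ≢_) xs → count (move p a t) w xs ≡ count p w xs
count-move-∉ p t w [] = refl
count-move-∉ p t w (a≢x ∷ a∉xs) = cong₂ _+_ (cong (λ z → ind z w) (move-off p t (a≢x ∘ sym))) (count-move-∉ p t w a∉xs)

count-move : ∀ p t w {a xs} → Unique xs → a ∈ xs →
  count (move p a t) w xs + ind (p a) w ≡ count p w xs + ind t w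
count-move p t w {a} {_ ∷ xs} (a∉xs ∷ _) (here refl)
  rewrite move-at p a t | count-move-∉ p t w a∉xs = swap (ind t w) (count p w xs) (ind (p a) w)
  where
  swap : ∀ a b c → a + b + c ≡ c + b + a
  swap = solve-∀
count-move p t w {a} {x ∷ xs} (x∉xs ∷ uniq) (there a∈xs)
  rewrite move-off p t {a} {x} (All.lookup x∉xs a∈xs)
  = trans (+-assoc (ind (p x) w) _ _) (trans (cong (ind (p x) w +_) (count-move p t w uniq a∈xs)) (sym (+-assoc (ind (p x) w) _ _)))

#chips : ℕ → Config → ℕ → ℕ
#chips N p w = length (chipsAt N p w)

#chips-move : ∀ N p t w {a} → Chip N a →
  #chips N (move p a t) w + ind (p a) w ≡ #chips N p w + ind t w
#chips-move N p t w {a} chip-a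
  rewrite length-filter (move p a t) w (labels N) | length-filter p w (labels N)
  = count-move p t w (labels-unique N) (chip∈labels chip-a)

-- Induction on the list: moving `x` away from `v`, to `suc v` say, lowers the count by one and
-- leaves the remaining chips in place.
#chips-≥ : ∀ N p v {xs} → Unique xs → All (λ x → Chip N x × p x ≡ v) xs → length xs ≤ #chips N p v
#chips-≥ N p v [] [] = z≤n
#chips-≥ N p v {x ∷ xs} (x∉xs ∷ uniq) ((chip-x , px≡v) ∷ all) = begin
  suc (length xs)                              ≤⟨ s≤s (#chips-≥ N p′ v uniq (All.zipWith keep (x∉xs , all))) ⟩
  suc (#chips N p′ v)                          ≡⟨ +-comm 1 _ ⟩
  #chips N p′ v + 1                            ≡⟨ cong (#chips N p′ v +_) (trans (cong (λ z → ind z v) px≡v) (ind-refl v)) ⟨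
  #chips N p′ v + ind (p x) v                  ≡⟨ #chips-move N p (suc v) v chip-x ⟩
  #chips N p v + ind (suc v) v                 ≡⟨ cong (#chips N p v +_) (ind-≢ {suc v} {v} 1+n≢n) ⟩
  #chips N p v + 0                             ≡⟨ +-identityʳ _ ⟩
  #chips N p v                                 ∎
  where
  open ≤-Reasoning
  p′ = move p x (suc v)
  keep : ∀ {y} → x ≢ y × (Chip N y × p y ≡ v) → Chip N y × p′ y ≡ v
  keep (x≢y , chip-y , py≡v) = chip-y , trans (move-off p (suc v) (x≢y ∘ sym)) py≡v

-- Odometers

module _ {N : ℕ} {p : Config} (v : ℕ) {a b c : ℕ} (1≤a : 1 ≤ a) (a<b : a < b) (b<c : b < c) (c≤N : c ≤ N)
         (pa : p a ≡ v) (pb : p b ≡ v) (pc : p c ≡ v) where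

  private
    p₁ = move p c (suc (2 * v))
    p₂ = move p₁ b (parent v)

  firing-chips : Chip N a × Chip N b × Chip N c
  firing-chips = (1≤a , ≤-trans (<⇒≤ a<b) (proj₂ chip-b)) , chip-b , (≤-trans (proj₁ chip-b) (<⇒≤ b<c) , c≤N)
    where
    chip-b : Chip N b
    chip-b = ≤-trans 1≤a (<⇒≤ a<b) , ≤-trans (<⇒≤ b<c) c≤N

  #chips-fire : ∀ {w} → 1 ≤ v → 1 ≤ w →
    #chips N (fire p v a b c) w + 3 * ind v w ≡ #chips N p w + around (ind v) w
  #chips-fire {w} 1≤v 1≤w = begin
    #chips N p₃ w + 3 * ind v w                           ≡⟨ split (#chips N p₃ w) (ind v w) ⟩
    (#chips N p₃ w + ind v w) + ind v w + ind v w         ≡⟨ cong (λ z → z + ind v w + ind v w) move-a ⟩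
    (#chips N p₂ w + ind (2 * v) w) + ind v w + ind v w   ≡⟨ shift (#chips N p₂ w) (ind (2 * v) w) (ind v w) ⟩
    (#chips N p₂ w + ind v w) + ind v w + ind (2 * v) w   ≡⟨ cong (λ z → z + ind v w + ind (2 * v) w) move-b ⟩
    (#chips N p₁ w + ind (parent v) w) + ind v w + ind (2 * v) w
      ≡⟨ shift′ (#chips N p₁ w) (ind (parent v) w) (ind v w) (ind (2 * v) w) ⟩
    (#chips N p₁ w + ind v w) + ind (parent v) w + ind (2 * v) w
      ≡⟨ cong (λ z → z + ind (parent v) w + ind (2 * v) w) move-c ⟩
    (#chips N p w + ind (suc (2 * v)) w) + ind (parent v) w + ind (2 * v) w
      ≡⟨ collect (#chips N p w) (ind (suc (2 * v)) w) (ind (parent v) w) (ind (2 * v) w) ⟩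
    #chips N p w + (ind (parent v) w + ind (2 * v) w + ind (suc (2 * v)) w)
      ≡⟨ cong (#chips N p w +_) (edge-sym 1≤v 1≤w) ⟩
    #chips N p w + around (ind v) w                       ∎
    where
    open ≡-Reasoning
    p₃ = fire p v a b c
    p₁b : p₁ b ≡ v
    p₁b = trans (move-off p (suc (2 * v)) (<⇒≢ b<c)) pb
    p₂a : p₂ a ≡ v
    p₂a = trans (move-off p₁ (parent v) (<⇒≢ a<b)) (trans (move-off p (suc (2 * v)) (<⇒≢ (<-trans a<b b<c))) pa)
    moved : ∀ q t {x} → Chip N x → q x ≡ v → #chips N (move q x t) w + ind v w ≡ #chips N q w + ind t w
    moved q t {x} chip-x qx≡v = subst (λ z → #chips N (move q x t) w + ind z w ≡ #chips N q w + ind t w) qx≡v (#chips-move N q t w chip-x)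
    move-a = moved p₂ (2 * v) (proj₁ firing-chips) p₂a
    move-b = moved p₁ (parent v) (proj₁ (proj₂ firing-chips)) p₁b
    move-c = moved p (suc (2 * v)) (proj₂ (proj₂ firing-chips)) pc
    split : ∀ x i → x + 3 * i ≡ x + i + i + i
    split = solve-∀
    shift : ∀ x l i → x + l + i + i ≡ x + i + i + l
    shift = solve-∀
    shift′ : ∀ x m i l → x + m + i + l ≡ x + i + m + l
    shift′ = solve-∀
    collect : ∀ x r m l → x + r + m + l ≡ x + (m + l + r)
    collect = solve-∀

  fire-least : fire p v a b c a ≡ 2 * v
  fire-least = move-at p₂ a (2 * v)

  fire-middle : fire p v a b c b ≡ parent v
  fire-middle = trans (move-off p₂ (2 * v) (>⇒≢ a<b)) (move-at p₁ b (parent v))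

  fire-greatest : fire p v a b c c ≡ suc (2 * v)
  fire-greatest = trans (move-off p₂ (2 * v) (>⇒≢ (<-trans a<b b<c)))
    (trans (move-off p₁ (parent v) (>⇒≢ b<c)) (move-at p c (suc (2 * v))))

  fire-other : ∀ {x} → x ≢ a → x ≢ b → x ≢ c → fire p v a b c x ≡ p x
  fire-other x≢a x≢b x≢c = trans (move-off p₂ (2 * v) x≢a)
    (trans (move-off p₁ (parent v) x≢b) (move-off p (suc (2 * v)) x≢c))

odometer : ∀ {N p q} → Reachable N p q → ℕ → ℕ
odometer ε w = 0
odometer (step v _ _ _ _ _ _ _ _ _ _ ◅ r) w = ind v w + odometer r w

odometer-bounded : ∀ {N p q} (r : Reachable N p q) → ∃ λ B → ∀ {v} → B < v → odometer r v ≡ 0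
odometer-bounded ε = 0 , λ _ → refl
odometer-bounded (step v _ _ _ _ _ _ _ _ _ _ ◅ r) with odometer-bounded r
... | B , zero-above = v ⊔ B , λ lt →
  cong₂ _+_ (ind-≢ (<⇒≢ (≤-<-trans (m≤m⊔n v B) lt))) (zero-above (≤-<-trans (m≤n⊔m v B) lt))

-- The value `0` is no node of the tree; positivity is kept by every firing and so confines a run to
-- actual nodes.
Positive : Config → Set
Positive p = ∀ x → 1 ≤ p x

move-positive : ∀ {p} a {t} → 1 ≤ t → Positive p → Positive (move p a t)
move-positive a 1≤t pos x with x ≡ᵇ a
... | true = 1≤t
... | false = pos x

fire-positive : ∀ {p v} a b c → 1 ≤ v → Positive p → Positive (fire p v a b c)
fire-positive a b c 1≤v pos =
  move-positive a (<⇒≤ (left≥2 1≤v)) (move-positive b (parent≥1 1≤v) (move-positive c (s≤s z≤n) pos))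

-- Chip conservation: a firing of `w` removes three chips, a firing of a neighbour adds one. Final
-- counts thus depend on the run only through its odometer.
balance : ∀ {N p q} (r : Reachable N p q) → Positive p → ∀ {w} → 1 ≤ w →
  #chips N q w + 3 * odometer r w ≡ #chips N p w + around (odometer r) w
balance ε pos 1≤w = refl
balance {N} {p} {q} (step v a b c 1≤a a<b b<c c≤N pa pb pc ◅ r) pos {w} 1≤w = begin
  #chips N q w + 3 * (ind v w + o w)              ≡⟨ split (#chips N q w) (ind v w) (o w) ⟩
  (#chips N q w + 3 * o w) + 3 * ind v w          ≡⟨ cong (_+ 3 * ind v w) (balance r (fire-positive a b c 1≤v pos) 1≤w) ⟩
  (#chips N p′ w + around o w) + 3 * ind v w      ≡⟨ swap (#chips N p′ w) (around o w) (3 * ind v w) ⟩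
  (#chips N p′ w + 3 * ind v w) + around o w      ≡⟨ cong (_+ around o w) (#chips-fire v 1≤a a<b b<c c≤N pa pb pc 1≤v 1≤w) ⟩
  (#chips N p w + around (ind v) w) + around o w
    ≡⟨ merge (#chips N p w) (ind v (parent w)) (ind v (2 * w)) (ind v (suc (2 * w))) (o (parent w)) (o (2 * w)) (o (suc (2 * w))) ⟩
  #chips N p w + around (λ x → ind v x + o x) w   ∎
  where
  open ≡-Reasoning
  o = odometer r
  p′ = fire p v a b c
  1≤v = subst (1 ≤_) pa (pos a)
  split : ∀ f i o → f + 3 * (i + o) ≡ f + 3 * o + 3 * i
  split = solve-∀
  swap : ∀ x y z → x + y + z ≡ x + z + y
  swap = solve-∀
  merge : ∀ f a b c x y z → f + (a + b + c) + (x + y + z) ≡ f + (a + x + (b + y) + (c + z))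
  merge = solve-∀

-- If u exceeds w at a node, the inequality forces the excess to grow by at least one towards the
-- parent, starting from deep nodes where u vanishes; at the root, its own parent, this is absurd.
module MaximumPrinciple
  (u w : ℕ → ℕ) (B : ℕ) (zero-above : ∀ {v} → B < v → u v ≡ 0)
  (subharmonic : ∀ {v} → 1 ≤ v → u v ≡ 0 ⊎ 3 * u v + around w v ≤ 1 + 3 * w v + around u v) where

  -- In terms of the excess e = u - w, the second case is e(v) + 1 ≤ e(parent v), rearranged to
  -- avoid subtraction.
  Grows : ℕ → Set
  Grows v = u v ≤ w v ⊎ suc (u v) + w (parent v) ≤ w v + u (parent v)

  grows-child : ∀ {v c} → w v < u v → parent c ≡ v → Grows c → suc (u c) + w v ≤ w c + u v
  grows-child {v} {c} w<u refl (inj₂ le) = le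
  grows-child {v} {c} w<u refl (inj₁ uc≤wc) = begin
    suc (u c) + w v  ≡⟨ +-suc (u c) (w v) ⟨
    u c + suc (w v)  ≤⟨ +-mono-≤ uc≤wc w<u ⟩
    w c + u v        ∎
    where open ≤-Reasoning

  -- Induction from deep nodes upwards: children have larger labels than `v`, so a smaller `k`
  -- suffices for them.
  grows : ∀ k {v} → B < k + v → 1 ≤ v → Grows v
  grows zero B<v _ = inj₁ (subst (_≤ _) (sym (zero-above B<v)) z≤n)
  grows (suc k) {v} B<k+v 1≤v with u v ≤? w v | subharmonic 1≤v
  ... | yes u≤w | _ = inj₁ u≤w
  ... | no _ | inj₁ u≡0 = inj₁ (subst (_≤ _) (sym u≡0) z≤n)
  -- With e = u - w, `subharmonic` reads 3e ≤ 1 + e(parent) + e(left) + e(right), and both children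
  -- have excess at most e - 1; hence e + 1 ≤ e(parent).
  ... | no u≰w | inj₂ sub = inj₂ (+-cancelˡ-≤ (1 + 2 * u v + 2 * w v + uL + uR + wL + wR) _ _
    (subst₂ _≤_ (lhs (u v) (w v) uL uR wL wR (w (parent v))) (rhs (u v) (w v) uL uR wL wR (u (parent v)))
      (+-mono-≤ sub (+-mono-≤ (child (2 * v) v<2v (parent-left 1≤v)) (child (suc (2 * v)) (m≤n⇒m≤1+n v<2v) (parent-right 1≤v))))))
    where
    uL = u (2 * v)
    uR = u (suc (2 * v))
    wL = w (2 * v)
    wR = w (suc (2 * v))
    v<2v : v < 2 * v
    v<2v = subst (_< 2 * v) (parent-left 1≤v) (parent< (left≥2 1≤v))
    child : ∀ c → v < c → parent c ≡ v → suc (u c) + w v ≤ w c + u v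
    child c v<c par = grows-child (≰⇒> u≰w) par
      (grows k (≤-trans B<k+v (≤-trans (≤-reflexive (sym (+-suc k v))) (+-monoʳ-≤ k v<c))) (≤-trans 1≤v (<⇒≤ v<c)))
    lhs : ∀ u w uL uR wL wR wP →
      3 * u + (wP + wL + wR) + ((suc uL + w) + (suc uR + w)) ≡ (1 + 2 * u + 2 * w + uL + uR + wL + wR) + (suc u + wP)
    lhs = solve-∀
    rhs : ∀ u w uL uR wL wR uP →
      1 + 3 * w + (uP + uL + uR) + ((wL + u) + (wR + u)) ≡ (1 + 2 * u + 2 * w + uL + uR + wL + wR) + (w + uP)
    rhs = solve-∀

  all-grow : ∀ {v} → 1 ≤ v → Grows v
  all-grow {v} = grows (suc B) (s≤s (m≤m+n B v))

  dominated : ∀ {v} → 1 ≤ v → u v ≤ w v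
  dominated = node-rec (λ v → u v ≤ w v) root extend
    where
    root : u 1 ≤ w 1
    root with all-grow {1} (s≤s z≤n)
    ... | inj₁ u≤w = u≤w
    ... | inj₂ absurd = ⊥-elim (<-irrefl (+-comm (u 1) (w 1)) absurd)
    extend : ∀ {v} → 2 ≤ v → u (parent v) ≤ w (parent v) → u v ≤ w v
    extend {v} 2≤v ih with all-grow {v} (<⇒≤ 2≤v)
    ... | inj₁ u≤w = u≤w
    ... | inj₂ le = <⇒≤ (+-cancelʳ-≤ (w (parent v)) _ _ (≤-trans le (+-monoʳ-≤ (w v) ih)))

-- The odometer of a stabilization

-- The number of nodes of a perfect binary tree with `d` levels.
perfect : ℕ → ℕ
perfect zero = 0
perfect (suc d) = suc (2 * perfect d)

1+perfect : ∀ d → suc (perfect d) ≡ 2 ^ d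
1+perfect zero = refl
1+perfect (suc d) = trans (double (perfect d)) (cong (2 *_) (1+perfect d))
  where
  double : ∀ e → suc (suc (2 * e)) ≡ 2 * suc e
  double = solve-∀

-- A node at height d fires perfect d times more than its child, whose subtree ends up with perfect d chips.
firings : ℕ → ℕ
firings zero = 0
firings (suc d) = firings d + perfect (suc d)

-- The initial case of the invariants that compare heights with firings still to come.
≤-firings : ∀ d → d ≤ firings d
≤-firings zero = z≤n
≤-firings (suc d) = subst (_≤ firings (suc d)) (+-comm d 1) (+-mono-≤ (≤-firings d) (s≤s z≤n))

-- The balance at a node other than the root that ends with one chip. For `d` zero, `pred` gives 0,
-- which is right because the children never fire.
firings-balance : ∀ d → 1 + 3 * firings d ≡ firings (suc d) + 2 * firings (pred d)
firings-balance zero = refl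
firings-balance (suc d) = identity (firings d) (perfect d)
  where
  identity : ∀ t e → 1 + 3 * (t + suc (2 * e)) ≡ t + suc (2 * e) + suc (2 * suc (2 * e)) + 2 * t
  identity = solve-∀

-- The root is its own parent and starts with all `perfect (suc d)` chips.
firings-balance-root : ∀ d → 1 + 3 * firings d ≡ perfect (suc d) + (firings d + 2 * firings (pred d))
firings-balance-root zero = refl
firings-balance-root (suc d) = identity (firings d) (perfect d)
  where
  identity : ∀ t e → 1 + 3 * (t + suc (2 * e)) ≡ suc (2 * suc (2 * e)) + (t + suc (2 * e) + 2 * t)
  identity = solve-∀

#chips-initial : ∀ N v → #chips N initial v ≡ ind 1 v * N
#chips-initial N v = trans (length-filter initial v (labels N))
  (trans (constant (labels N)) (cong (ind 1 v *_) (trans (length-map suc (upTo N)) (length-upTo N))))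
  where
  constant : ∀ xs → count initial v xs ≡ ind 1 v * length xs
  constant [] = sym (*-zeroʳ (ind 1 v))
  constant (x ∷ xs) = trans (cong (ind 1 v +_) (constant xs)) (sym (*-suc (ind 1 v) (length xs)))

-- `M` stands for n - 1, the depth of the lowest level to be filled.
module Tree (M : ℕ) where

  N : ℕ
  N = 2 ^ suc M ∸ 1

  N≡perfect : N ≡ perfect (suc M)
  N≡perfect = cong (_∸ 1) (sym (1+perfect (suc M)))

  ≤N⇒depth≤ : ∀ {v} → 1 ≤ v → v ≤ N → depth v ≤ M
  ≤N⇒depth≤ {v} 1≤v v≤N = ≤-pred (proj₂ (depth<⇔<2^ 1≤v) (subst (v <_) (1+perfect (suc M)) (s≤s (subst (v ≤_) N≡perfect v≤N))))

  depth≤⇒≤N : ∀ {v} → 1 ≤ v → depth v ≤ M → v ≤ N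
  depth≤⇒≤N {v} 1≤v d≤M = subst (v ≤_) (sym N≡perfect) (≤-pred (subst (v <_) (sym (1+perfect (suc M))) (proj₁ (depth<⇔<2^ 1≤v) (s≤s d≤M))))

  -- Truncated subtraction gives height 0, and hence no firings in `target`, to all nodes below
  -- level n as well.
  height : ℕ → ℕ
  height v = M ∸ depth v

  height-child : ∀ {c} → 2 ≤ c → height c ≡ pred (height (parent c))
  height-child {c} 2≤c = trans (cong (M ∸_) (depth-parent 2≤c)) (sym (pred[m∸n]≡m∸[1+n] M (depth (parent c))))

  height-left : ∀ {v} → 1 ≤ v → height (2 * v) ≡ pred (height v)
  height-left 1≤v = trans (height-child (left≥2 1≤v)) (cong (pred ∘ height) (parent-left 1≤v))

  height-right : ∀ {v} → 1 ≤ v → height (suc (2 * v)) ≡ pred (height v)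
  height-right 1≤v = trans (height-child (right≥2 1≤v)) (cong (pred ∘ height) (parent-right 1≤v))

  target : ℕ → ℕ
  target v = firings (height v)

  filled : ℕ → ℕ
  filled v with depth v ≤? M
  ... | yes _ = 1
  ... | no _ = 0

  filled≤1 : ∀ v → filled v ≤ 1
  filled≤1 v with depth v ≤? M
  ... | yes _ = s≤s z≤n
  ... | no _ = z≤n

  filled-within : ∀ {v} → depth v ≤ M → filled v ≡ 1
  filled-within {v} d≤M with depth v ≤? M
  ... | yes _ = refl
  ... | no d≰M = ⊥-elim (d≰M d≤M)

  filled-below : ∀ {v} → M < depth v → filled v ≡ 0
  filled-below {v} M<d with depth v ≤? M
  ... | yes d≤M = ⊥-elim (<⇒≱ M<d d≤M)
  ... | no _ = refl

  target-balance : ∀ {v} → 1 ≤ v → filled v + 3 * target v ≡ #chips N initial v + around target v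
  target-balance {v} 1≤v rewrite #chips-initial N v | height-left 1≤v | height-right 1≤v = go v 1≤v
    where
    double : ∀ a b → a + b + b ≡ a + 2 * b
    double = solve-∀
    go : ∀ v → 1 ≤ v → filled v + 3 * target v ≡ ind 1 v * N + (target (parent v) + firings (pred (height v)) + firings (pred (height v)))
    go (suc zero) _ with 0 ≤? M
    ... | no 0≰M = ⊥-elim (0≰M z≤n)
    ... | yes _ = begin
      1 + 3 * firings M                                        ≡⟨ firings-balance-root M ⟩
      perfect (suc M) + (firings M + 2 * firings (pred M))     ≡⟨ cong₂ _+_ (trans (sym N≡perfect) (sym (*-identityˡ N))) (sym (double (firings M) (firings (pred M)))) ⟩
      1 * N + (firings M + firings (pred M) + firings (pred M)) ∎
      where open ≡-Reasoning
    go v@(suc (suc _)) _ with depth v ≤? M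
    ... | yes d≤M = begin
      1 + 3 * firings (height v)                                ≡⟨ firings-balance (height v) ⟩
      firings (suc (height v)) + 2 * firings (pred (height v))  ≡⟨ cong (λ z → firings z + 2 * firings (pred (height v))) up ⟩
      target (parent v) + 2 * firings (pred (height v))         ≡⟨ double (target (parent v)) (firings (pred (height v))) ⟨
      target (parent v) + firings (pred (height v)) + firings (pred (height v)) ∎
      where
      open ≡-Reasoning
      dv : depth v ≡ suc (depth (parent v))
      dv = depth-parent {v} (s≤s (s≤s z≤n))
      up : suc (height v) ≡ height (parent v)
      up = trans (cong (λ z → suc (M ∸ z)) dv) (sym (+-∸-assoc 1 (subst (_≤ M) dv d≤M)))
    -- Below level n the node, its parent and its children all have height 0, so every term
    -- vanishes.
    ... | no d≰M rewrite m≤n⇒m∸n≡0 (<⇒≤ (≰⇒> d≰M))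
                       | m≤n⇒m∸n≡0 {M} {depth (parent v)} (≤-pred (subst (M <_) (depth-parent {v} (s≤s (s≤s z≤n))) (≰⇒> d≰M))) = refl

  module _ {q : Config} (r : Reachable N initial q) (stable : Terminal N q) where

    -- Chip counts are at least 0 and `filled` is at most 1, so subtracting the two balances leaves
    -- the slack 1 that the maximum principle allows.
    odometer≤target : ∀ {v} → 1 ≤ v → odometer r v ≤ target v
    odometer≤target = MaximumPrinciple.dominated (odometer r) target (proj₁ bounded) (proj₂ bounded) (λ 1≤v → inj₂ (sub 1≤v))
      where
      bounded = odometer-bounded r
      sub : ∀ {v} → 1 ≤ v → 3 * odometer r v + around target v ≤ 1 + 3 * target v + around (odometer r) v
      sub {v} 1≤v = begin
        3 * o v + around target v                            ≤⟨ m≤n+m _ (#chips N q v) ⟩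
        #chips N q v + (3 * o v + around target v)           ≡⟨ +-assoc (#chips N q v) _ _ ⟨
        (#chips N q v + 3 * o v) + around target v           ≡⟨ cong (_+ around target v) (balance r (λ _ → s≤s z≤n) 1≤v) ⟩
        (#chips N initial v + around o v) + around target v  ≡⟨ swap (#chips N initial v) (around o v) (around target v) ⟩
        (#chips N initial v + around target v) + around o v  ≡⟨ cong (_+ around o v) (target-balance 1≤v) ⟨
        filled v + 3 * target v + around o v                 ≤⟨ +-monoˡ-≤ _ (+-monoˡ-≤ _ (filled≤1 v)) ⟩
        1 + 3 * target v + around o v                        ∎
        where
        open ≤-Reasoning
        o = odometer r
        swap : ∀ x y z → x + y + z ≡ x + z + y
        swap = solve-∀

    -- With the roles exchanged, stability leaves at most 2 chips against 1 on the first n levels,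
    -- again slack 1; below them `target` vanishes.
    target≤odometer : ∀ {v} → 1 ≤ v → target v ≤ odometer r v
    target≤odometer = MaximumPrinciple.dominated target (odometer r) N above sub
      where
      above : ∀ {v} → N < v → target v ≡ 0
      above {v} N<v = cong firings (m≤n⇒m∸n≡0 (<⇒≤ (≰⇒> λ d≤M → <⇒≱ N<v (depth≤⇒≤N (≤-trans (s≤s z≤n) N<v) d≤M))))
      o = odometer r
      sub : ∀ {v} → 1 ≤ v → target v ≡ 0 ⊎ 3 * target v + around o v ≤ 1 + 3 * o v + around target v
      sub {v} 1≤v with depth v ≤? M | target-balance 1≤v
      ... | no d≰M | _ = inj₁ (cong firings (m≤n⇒m∸n≡0 (<⇒≤ (≰⇒> d≰M))))
      ... | yes d≤M | bal = inj₂ (≤-pred (begin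
        1 + 3 * target v + around o v                        ≡⟨ cong (_+ around o v) bal ⟩
        (#chips N initial v + around target v) + around o v  ≡⟨ swap (#chips N initial v) (around target v) (around o v) ⟩
        (#chips N initial v + around o v) + around target v  ≡⟨ cong (_+ around target v) (balance r (λ _ → s≤s z≤n) 1≤v) ⟨
        #chips N q v + 3 * o v + around target v             ≤⟨ +-monoˡ-≤ _ (+-monoˡ-≤ _ (stable v)) ⟩
        2 + 3 * o v + around target v                        ∎))
        where
        open ≤-Reasoning
        swap : ∀ x y z → x + y + z ≡ x + z + y
        swap = solve-∀

    odometer≡target : ∀ {v} → 1 ≤ v → odometer r v ≡ target v
    odometer≡target 1≤v = ≤-antisym (odometer≤target 1≤v) (target≤odometer 1≤v)

    #chips-final : ∀ {v} → 1 ≤ v → #chips N q v ≡ filled v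
    #chips-final {v} 1≤v = +-cancelʳ-≡ (3 * target v) _ _ (begin
      #chips N q v + 3 * target v              ≡⟨ cong (λ z → #chips N q v + 3 * z) (odometer≡target 1≤v) ⟨
      #chips N q v + 3 * odometer r v          ≡⟨ balance r (λ _ → s≤s z≤n) 1≤v ⟩
      #chips N initial v + around (odometer r) v
        ≡⟨ cong (#chips N initial v +_) (cong₂ _+_ (cong₂ _+_ (odometer≡target (parent≥1 1≤v)) (odometer≡target (<⇒≤ (left≥2 1≤v)))) (odometer≡target (s≤s z≤n))) ⟩
      #chips N initial v + around target v     ≡⟨ target-balance 1≤v ⟨
      filled v + 3 * target v                  ∎)
      where open ≡-Reasoning

-- The last firings of a run

squeeze : ∀ {a a₀ b b₀} → a₀ ≤ a → b₀ ≤ b → a + b ≤ a₀ + b₀ → a ≡ a₀ × b ≡ b₀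
squeeze {a} {a₀} {b} {b₀} a₀≤a b₀≤b le =
    ≤-antisym (+-cancelʳ-≤ b₀ _ _ (≤-trans (+-monoʳ-≤ a b₀≤b) le)) a₀≤a
  , ≤-antisym (+-cancelˡ-≤ a₀ _ _ (≤-trans (+-monoˡ-≤ b a₀≤a) le)) b₀≤b

module Dynamics (M : ℕ) where
  open Tree M

  -- In particular D c ≤ D (parent c) ≤ 1 + D c as soon as D c < height c, where D counts the firings
  -- still to come: towards the end of a run, neighbours fire alternately.
  record Interlocked (D : ℕ → ℕ) : Set where
    field
      child≥  : ∀ {c m} → 2 ≤ c → m ≤ height c → m < D (parent c) → m ≤ D c
      parent≥ : ∀ {c m} → 2 ≤ c → m ≤ height c → m ≤ D c → m ≤ D (parent c)

  module _ {D : ℕ → ℕ} (lock : Interlocked D) {v f m : ℕ} (1≤v : 1 ≤ v) (3≤f : 3 ≤ f)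
           (bal : filled v + 3 * D v ≡ f + around D v) (Dv : D v ≡ suc m) (m<h : suc m ≤ height v) where
    open Interlocked lock

    private
      up≥ : suc m ≤ D (parent v)
      up≥ with m≤n⇒m<n∨m≡n 1≤v
      ... | inj₁ 2≤v  = parent≥ 2≤v m<h (≤-reflexive (sym Dv))
      ... | inj₂ refl = ≤-reflexive (sym Dv)

      down≥ : ∀ {c} → 2 ≤ c → parent c ≡ v → m ≤ D c
      down≥ 2≤c refl = child≥ 2≤c (subst (m ≤_) (sym (height-child 2≤c)) (pred-mono-≤ m<h)) (≤-reflexive (sym Dv))

      left-down≥ : m ≤ D (2 * v)
      left-down≥ = down≥ (left≥2 1≤v) (parent-left 1≤v)

      right-down≥ : m ≤ D (suc (2 * v))
      right-down≥ = down≥ (right≥2 1≤v) (parent-right 1≤v)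

      total≤ : f + around D v ≤ 3 + (suc m + m + m)
      total≤ = begin
        f + around D v       ≡⟨ bal ⟨
        filled v + 3 * D v   ≤⟨ +-monoˡ-≤ _ (filled≤1 v) ⟩
        1 + 3 * D v          ≡⟨ cong (λ z → 1 + 3 * z) Dv ⟩
        1 + 3 * suc m        ≡⟨ identity m ⟩
        3 + (suc m + m + m)  ∎
        where
        open ≤-Reasoning
        identity : ∀ m → 1 + 3 * suc m ≡ 3 + (suc m + m + m)
        identity = solve-∀

    -- By `total≤` the four summands add up to at most 3, `suc m`, `m` and `m` together, while each
    -- is at least its own value in this list. So all the bounds are attained.
    tight : f ≡ 3 × D (parent v) ≡ suc m × D (2 * v) ≡ m × D (suc (2 * v)) ≡ m
    tight with squeeze 3≤f (+-mono-≤ (+-mono-≤ up≥ left-down≥) right-down≥) total≤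
    ... | f≡3 , around≡ with squeeze (+-mono-≤ up≥ left-down≥) right-down≥ (≤-reflexive around≡)
    ... | rest≡ , right≡ with squeeze up≥ left-down≥ (≤-reflexive rest≡)
    ... | up≡ , left≡ = f≡3 , up≡ , left≡ , right≡

  -- One firing, where `D` and `E` count the firings still to come before and after it. The order
  -- and the child maps are parameters so that the mirror image is again a `Firing`.
  record Firing (_≺_ : ℕ → ℕ → Set) (L R : ℕ → ℕ) (p q : Config) (D E : ℕ → ℕ) : Set where
    field
      {v a b c} : ℕ
      1≤v       : 1 ≤ v
      chip-a    : Chip N a
      chip-b    : Chip N b
      chip-c    : Chip N c
      a≺b       : a ≺ b
      b≺c       : b ≺ c
      pa        : p a ≡ v
      pb        : p b ≡ v
      pc        : p c ≡ v
      qa        : q a ≡ L v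
      qb        : q b ≡ parent v
      qc        : q c ≡ R v
      q-other   : ∀ {x} → x ≢ a → x ≢ b → x ≢ c → q x ≡ p x
      D-step    : ∀ w → D w ≡ ind v w + E w
      locked    : Interlocked D
      up-tight  : ∀ {m} → D v ≡ suc m → suc m ≤ height v → D (parent v) ≡ suc m
      L-tight   : ∀ {m} → D v ≡ suc m → suc m ≤ height v → D (L v) ≡ m
      R-tight   : ∀ {m} → D v ≡ suc m → suc m ≤ height v → D (R v) ≡ m
      exhausted : ∀ {x} → D v ≤ height v → Chip N x → p x ≡ v → x ≡ a ⊎ x ≡ b ⊎ x ≡ c

    D-at : D v ≡ suc (E v)
    D-at = trans (D-step v) (cong (_+ E v) (ind-refl v))

    D-off : ∀ {w} → w ≢ v → D w ≡ E w
    D-off {w} w≢v = trans (D-step w) (cong (_+ E w) (ind-≢ (w≢v ∘ sym)))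

    E≤D : ∀ w → E w ≤ D w
    E≤D w = subst (E w ≤_) (sym (D-step w)) (m≤n+m (E w) (ind v w))

  reflect : ∀ {_≺_ L R p q D E} → Firing _≺_ L R p q D E → Firing (flip _≺_) R L p q D E
  reflect F = record
    { 1≤v = 1≤v ; chip-a = chip-c ; chip-b = chip-b ; chip-c = chip-a ; a≺b = b≺c ; b≺c = a≺b
    ; pa = pc ; pb = pb ; pc = pa ; qa = qc ; qb = qb ; qc = qa
    ; q-other = λ x≢c x≢b x≢a → q-other x≢a x≢b x≢c
    ; D-step = D-step ; locked = locked
    ; up-tight = up-tight ; L-tight = R-tight ; R-tight = L-tight
    ; exhausted = λ le chip-x px → [ inj₂ ∘ inj₂ , [ inj₂ ∘ inj₁ , inj₁ ]′ ]′ (exhausted le chip-x px)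
    }
    where open Firing F

  -- `E` differs from `D` only at the firing node `v`, so a bound can break only there, and only
  -- with `m` equal to `D v`. Then the tight values of `D` at the neighbours contradict the premise.
  interlocked-after : ∀ {_≺_ p q D E} → Firing _≺_ (2 *_) (λ v → suc (2 * v)) p q D E → Interlocked E
  interlocked-after {D = D} {E} F = record { child≥ = child ; parent≥ = above }
    where
    open Firing F
    open Interlocked locked

    child : ∀ {c m} → 2 ≤ c → m ≤ height c → m < E (parent c) → m ≤ E c
    child {c} {m} 2≤c m≤h m<E with child≥ 2≤c m≤h (≤-trans m<E (E≤D (parent c))) | c ≟ v
    ... | m≤D | no c≢v = subst (m ≤_) (D-off c≢v) m≤D
    ... | m≤D | yes refl with m≤n⇒m<n∨m≡n (subst (m ≤_) D-at m≤D)
    ...   | inj₁ m<1+E = ≤-pred m<1+E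
    ...   | inj₂ refl = ⊥-elim (<⇒≱ m<E (≤-trans (E≤D (parent v)) (≤-reflexive (up-tight D-at m≤h))))

    above : ∀ {c m} → 2 ≤ c → m ≤ height c → m ≤ E c → m ≤ E (parent c)
    above {c} {m} 2≤c m≤h m≤E with parent≥ 2≤c m≤h (≤-trans m≤E (E≤D c)) | parent c ≟ v
    ... | m≤D | no c≢v = subst (m ≤_) (D-off c≢v) m≤D
    ... | m≤D | yes refl with m≤n⇒m<n∨m≡n (subst (m ≤_) D-at m≤D)
    ...   | inj₁ m<1+E = ≤-pred m<1+E
    ...   | inj₂ refl = ⊥-elim (<⇒≱ m≤E (≤-trans (E≤D c) (≤-reflexive Dc)))
      where
      m≤height : suc (E v) ≤ height v
      m≤height = ≤-trans m≤h (≤-trans (≤-reflexive (height-child 2≤c)) pred[n]≤n)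
      Dc : D c ≡ E v
      Dc with left-or-right 2≤c
      ... | inj₁ eq = trans (cong D eq) (L-tight D-at m≤height)
      ... | inj₂ eq = trans (cong D eq) (R-tight D-at m≤height)

  -- The balance of the remaining run, whose final counts are known, makes `tight` applicable; a
  -- fourth chip at `v` would contradict its count of three.
  firing : ∀ {p p′ q} (s : Step N p p′) (r : Reachable N p′ q) → Positive p →
    (∀ {v} → 1 ≤ v → #chips N q v ≡ filled v) → Interlocked (odometer (s ◅ r)) →
    Firing _<_ (2 *_) (λ v → suc (2 * v)) p p′ (odometer (s ◅ r)) (odometer r)
  firing {p} {p′} {q} s@(step v a b c 1≤a a<b b<c c≤N pa pb pc) r pos final lock = record
    { 1≤v = 1≤v ; chip-a = proj₁ chips ; chip-b = proj₁ (proj₂ chips) ; chip-c = proj₂ (proj₂ chips)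
    ; a≺b = a<b ; b≺c = b<c ; pa = pa ; pb = pb ; pc = pc
    ; qa = fire-least v 1≤a a<b b<c c≤N pa pb pc
    ; qb = fire-middle v 1≤a a<b b<c c≤N pa pb pc
    ; qc = fire-greatest v 1≤a a<b b<c c≤N pa pb pc
    ; q-other = fire-other v 1≤a a<b b<c c≤N pa pb pc
    ; D-step = λ _ → refl
    ; locked = lock
    ; up-tight = λ eq le → proj₁ (proj₂ (tight lock 1≤v 3≤f bal eq le))
    ; L-tight = λ eq le → proj₁ (proj₂ (proj₂ (tight lock 1≤v 3≤f bal eq le)))
    ; R-tight = λ eq le → proj₂ (proj₂ (proj₂ (tight lock 1≤v 3≤f bal eq le)))
    ; exhausted = exhaust
    }
    where
    D = odometer (s ◅ r)
    1≤v = subst (1 ≤_) pa (pos a)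
    chips = firing-chips {N} {p} v 1≤a a<b b<c c≤N pa pb pc
    a≢b = <⇒≢ a<b
    b≢c = <⇒≢ b<c
    a≢c = <⇒≢ (<-trans a<b b<c)
    D-at : D v ≡ suc (odometer r v)
    D-at = cong (_+ odometer r v) (ind-refl v)
    bal : filled v + 3 * D v ≡ #chips N p v + around D v
    bal = trans (cong (_+ 3 * D v) (sym (final 1≤v))) (balance (s ◅ r) pos 1≤v)
    three : All (λ x → Chip N x × p x ≡ v) (a ∷ b ∷ c ∷ [])
    three = (proj₁ chips , pa) ∷ (proj₁ (proj₂ chips) , pb) ∷ (proj₂ (proj₂ chips) , pc) ∷ []
    3≤f : 3 ≤ #chips N p v
    3≤f = #chips-≥ N p v ((a≢b ∷ a≢c ∷ []) ∷ (b≢c ∷ []) ∷ [] ∷ []) three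
    exhaust : ∀ {x} → D v ≤ height v → Chip N x → p x ≡ v → x ≡ a ⊎ x ≡ b ⊎ x ≡ c
    exhaust {x} D≤h chip-x px with x ≟ a | x ≟ b | x ≟ c
    ... | yes eq | _ | _ = inj₁ eq
    ... | no _ | yes eq | _ = inj₂ (inj₁ eq)
    ... | no _ | no _ | yes eq = inj₂ (inj₂ eq)
    ... | no x≢a | no x≢b | no x≢c = ⊥-elim (<⇒≱ 4≤f (≤-reflexive f≡3))
      where
      4≤f : 4 ≤ #chips N p v
      4≤f = #chips-≥ N p v ((x≢a ∷ x≢b ∷ x≢c ∷ []) ∷ (a≢b ∷ a≢c ∷ []) ∷ (b≢c ∷ []) ∷ [] ∷ []) ((chip-x , px) ∷ three)
      f≡3 : #chips N p v ≡ 3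
      f≡3 = proj₁ (tight lock 1≤v 3≤f bal D-at (subst (_≤ height v) D-at D≤h))

  -- Both bounds hold outright at the start: `D` is at least the height everywhere, and a parent is
  -- at least as high as its child.
  interlocked-target : ∀ {D} → (∀ {v} → 1 ≤ v → D v ≡ target v) → Interlocked D
  interlocked-target {D} D≡ = record { child≥ = child ; parent≥ = above }
    where
    child : ∀ {c m} → 2 ≤ c → m ≤ height c → m < D (parent c) → m ≤ D c
    child {c} {m} 2≤c m≤h _ = subst (m ≤_) (sym (D≡ (<⇒≤ 2≤c))) (≤-trans m≤h (≤-firings (height c)))
    above : ∀ {c m} → 2 ≤ c → m ≤ height c → m ≤ D c → m ≤ D (parent c)
    above {c} {m} 2≤c m≤h _ = subst (m ≤_) (sym (D≡ (parent≥1 (<⇒≤ 2≤c))))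
      (≤-trans m≤h (≤-trans (≤-trans (≤-reflexive (height-child 2≤c)) pred[n]≤n) (≤-firings (height (parent c)))))

  -- Minimal chips of subtrees, in either orientation

  module Oriented
    (_≺_ : ℕ → ℕ → Set) (≺-trans : ∀ {x y z} → x ≺ y → y ≺ z → x ≺ z) (≺-irrefl : ∀ {x} → ¬ (x ≺ x))
    (≺-induction : (P : ℕ → Set) → (∀ {y} → Chip N y → (∀ {z} → Chip N z → z ≺ y → P z) → P y) → ∀ {y} → Chip N y → P y)
    (L R : ℕ → ℕ)
    (L≥2 : ∀ {v} → 1 ≤ v → 2 ≤ L v) (R≥2 : ∀ {v} → 1 ≤ v → 2 ≤ R v)
    (parent-L : ∀ {v} → 1 ≤ v → parent (L v) ≡ v) (parent-R : ∀ {v} → 1 ≤ v → parent (R v) ≡ v)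
    (L≢R : ∀ {v w} → L v ≢ R w) (L-or-R : ∀ {v} → 2 ≤ v → v ≡ L (parent v) ⊎ v ≡ R (parent v))
    where

    descend : ℕ → ℕ → ℕ
    descend zero    i = i
    descend (suc j) i = L (descend j i)

    subtree-L : ∀ {i v} → 1 ≤ v → InSubtree i v → InSubtree i (L v)
    subtree-L 1≤v s = parent-subtree (<⇒≤ (L≥2 1≤v)) (subst (InSubtree _) (sym (parent-L 1≤v)) s)

    subtree-R : ∀ {i v} → 1 ≤ v → InSubtree i v → InSubtree i (R v)
    subtree-R 1≤v s = parent-subtree (<⇒≤ (R≥2 1≤v)) (subst (InSubtree _) (sym (parent-R 1≤v)) s)

    subtree-L⁻ : ∀ {i v} → 1 ≤ i → 1 ≤ v → InSubtree i (L v) → L v ≡ i ⊎ InSubtree i v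
    subtree-L⁻ 1≤i 1≤v s with subtree-parent 1≤i s
    ... | inj₁ eq = inj₁ eq
    ... | inj₂ s′ = inj₂ (subst (InSubtree _) (parent-L 1≤v) s′)

    subtree-R⁻ : ∀ {i v} → 1 ≤ i → 1 ≤ v → InSubtree i (R v) → R v ≡ i ⊎ InSubtree i v
    subtree-R⁻ 1≤i 1≤v s with subtree-parent 1≤i s
    ... | inj₁ eq = inj₁ eq
    ... | inj₂ s′ = inj₂ (subst (InSubtree _) (parent-R 1≤v) s′)

    descend-L : ∀ j i → descend j (L i) ≡ L (descend j i)
    descend-L zero i = refl
    descend-L (suc j) i = cong L (descend-L j i)

    descend≥1 : ∀ j {i} → 1 ≤ i → 1 ≤ descend j i
    descend≥1 zero 1≤i = 1≤i
    descend≥1 (suc j) 1≤i = <⇒≤ (L≥2 (descend≥1 j 1≤i))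

    depth-descend : ∀ j {i} → 1 ≤ i → depth (descend j i) ≡ j + depth i
    depth-descend zero 1≤i = refl
    depth-descend (suc j) 1≤i = trans (depth-parent (L≥2 (descend≥1 j 1≤i)))
      (cong suc (trans (cong depth (parent-L (descend≥1 j 1≤i))) (depth-descend j 1≤i)))

    -- Whenever the parent of i = R _ is one firing behind i late in a run, it holds a chip x beaten by a chip of
    -- the subtree of i. All chips at the parent take part in its next firing, so i receives a chip not below x,
    -- which is not a new minimum of the subtree.
    Guarded : ℕ → Config → (ℕ → ℕ) → Set
    Guarded i p D = D i < height i → D (parent i) ≡ suc (D i) →
      ∃₂ λ x y → Chip N x × Chip N y × p x ≡ parent i × InSubtree i (p y) × y ≺ x

    Minimum : ℕ → Config → ℕ → Set
    Minimum i p s = Chip N s × InSubtree i (p s) × (∀ {y} → Chip N y → InSubtree i (p y) → ¬ (y ≺ s))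

    -- The invariant of a run. Its second half says that enough firings remain to bring the minimum
    -- down to level n: once none are left, the height must be 0.
    MinimumDescends : ℕ → Config → (ℕ → ℕ) → Set
    MinimumDescends i p D = ∀ {s} → Minimum i p s → (∃ λ j → p s ≡ descend j i) × height (p s) ≤ D (p s)

    module _ {p q : Config} {D E : ℕ → ℕ} (F : Firing _≺_ L R p q D E) where
      open Firing F
      open Interlocked locked

      data Moved (x : ℕ) : Set where
        is-a  : x ≡ a → Moved x
        is-b  : x ≡ b → Moved x
        is-c  : x ≡ c → Moved x
        stays : q x ≡ p x → x ≢ a → x ≢ b → x ≢ c → Moved x

      moved : ∀ x → Moved x
      moved x with x ≟ a | x ≟ b | x ≟ c
      ... | yes eq | _ | _ = is-a eq
      ... | no _ | yes eq | _ = is-b eq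
      ... | no _ | no _ | yes eq = is-c eq
      ... | no x≢a | no x≢b | no x≢c = stays (q-other x≢a x≢b x≢c) x≢a x≢b x≢c

      unmoved : ∀ {x} → p x ≢ v → q x ≡ p x
      unmoved {x} px≢v with moved x
      ... | is-a refl = ⊥-elim (px≢v pa)
      ... | is-b refl = ⊥-elim (px≢v pb)
      ... | is-c refl = ⊥-elim (px≢v pc)
      ... | stays eq _ _ _ = eq

      a∈subtree : ∀ {i} → InSubtree i v → InSubtree i (q a)
      a∈subtree s = subst (InSubtree _) (sym qa) (subtree-L 1≤v s)

      c∈subtree : ∀ {i} → InSubtree i v → InSubtree i (q c)
      c∈subtree s = subst (InSubtree _) (sym qc) (subtree-R 1≤v s)

      -- Only the middle chip of a firing moves up, so a chip leaves the subtree of `i` only when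
      -- `i` itself fires.
      remains : ∀ {i x} → 1 ≤ i → v ≢ i → InSubtree i (p x) → InSubtree i (q x)
      remains {i} {x} 1≤i v≢i s with moved x
      ... | is-a refl = a∈subtree (subst (InSubtree i) pa s)
      ... | is-c refl = c∈subtree (subst (InSubtree i) pc s)
      ... | stays eq _ _ _ = subst (InSubtree i) (sym eq) s
      ... | is-b refl with subtree-parent 1≤i (subst (InSubtree i) pb s)
      ...   | inj₁ v≡i = ⊥-elim (v≢i v≡i)
      ...   | inj₂ s′ = subst (InSubtree i) (sym qb) s′

      guarded-after : ∀ {i} → 2 ≤ i → Guarded i p D → Guarded i q E
      guarded-after {i} 2≤i guard E<h E-parent with v ≟ i | v ≟ parent i
      -- The firing of `i` has just sent `b` to the parent and kept `a`, which precedes `b`, in the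
      -- subtree.
      ... | yes refl | _ = b , a , chip-b , chip-a , qb , a∈subtree here , a≺b
      -- Before its firing the parent would have had two more firings to come than `i`; late in the
      -- run `child≥` allows only one.
      ... | no v≢i | yes refl = ⊥-elim (<-irrefl refl (child≥ 2≤i
              (subst (_< height i) (sym Di) E<h)
              (subst₂ _<_ (trans E-parent (cong suc (sym Di))) (sym D-at) ≤-refl)))
        where
        Di : D i ≡ E i
        Di = D-off (v≢i ∘ sym)
      ... | no v≢i | no v≢parent
        with guard (subst (_< height i) (sym (D-off (v≢i ∘ sym))) E<h)
                   (trans (D-off (v≢parent ∘ sym)) (trans E-parent (cong suc (sym (D-off (v≢i ∘ sym))))))
      ... | x , y , chip-x , chip-y , px , y∈ , y≺x =
        x , y , chip-x , chip-y , trans (unmoved (λ px≡v → v≢parent (trans (sym px≡v) px))) px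
          , remains (<⇒≤ 2≤i) v≢i y∈ , y≺x

      -- The only chip that can have left the subtree is the middle one, and then `a`, which
      -- precedes it, is still there.
      minimum-before : ∀ {i s} → 1 ≤ i → InSubtree i (p s) → Minimum i q s → Minimum i p s
      minimum-before {i} {s} 1≤i s∈ (chip-s , _ , least) = chip-s , s∈ , least′
        where
        least′ : ∀ {y} → Chip N y → InSubtree i (p y) → ¬ (y ≺ s)
        least′ {y} chip-y y∈ y≺s with moved y
        ... | is-a refl = least chip-a (a∈subtree (subst (InSubtree i) pa y∈)) y≺s
        ... | is-b refl = least chip-a (a∈subtree (subst (InSubtree i) pb y∈)) (≺-trans a≺b y≺s)
        ... | is-c refl = least chip-c (c∈subtree (subst (InSubtree i) pc y∈)) y≺s
        ... | stays eq _ _ _ = least chip-y (subst (InSubtree i) (sym eq) y∈) y≺s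

      ≼c : ∀ {x y} → x ≡ a ⊎ x ≡ b ⊎ x ≡ c → y ≺ x → y ≺ c
      ≼c (inj₁ refl) y≺x = ≺-trans y≺x (≺-trans a≺b b≺c)
      ≼c (inj₂ (inj₁ refl)) y≺x = ≺-trans y≺x b≺c
      ≼c (inj₂ (inj₂ refl)) y≺x = y≺x

      -- Otherwise the guard yields `y` in the subtree of `R v` preceding some `x` at `v`; since `x`
      -- takes part in the firing, `y` also precedes `c`.
      late-entry : Minimum (R v) q c → Guarded (R v) p D → height (R v) ≤ D (R v)
      late-entry (_ , _ , least) guard = ≮⇒≥ λ D<h →
        let i = R v
            i≥2 = R≥2 1≤v
            par = parent-R 1≤v
            -- Interlocking places this among the last `height v` firings of `v`, which involve
            -- every chip at `v`.
            Dv≤ : D v ≤ suc (D i)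
            Dv≤ = ≮⇒≥ λ lt → <-irrefl refl (child≥ i≥2 D<h (subst (λ z → suc (D i) < D z) (sym par) lt))
            height≤ : height i ≤ height v
            height≤ = ≤-trans (≤-reflexive (trans (height-child i≥2) (cong (pred ∘ height) par))) pred[n]≤n
            Dv≤h : D v ≤ height v
            Dv≤h = ≤-trans Dv≤ (≤-trans D<h height≤)
            Di : D i ≡ E v
            Di = R-tight D-at (subst (_≤ height v) D-at Dv≤h)
            x , y , chip-x , chip-y , px , y∈ , y≺x =
              guard D<h (trans (cong D par) (trans D-at (cong suc (sym Di))))
            -- The firing node is the parent of `i`, outside its subtree, so `y` does not move.
            py≢v : p y ≢ v
            py≢v py≡v = parent∉subtree i≥2 (subst (InSubtree i) (trans py≡v (sym par)) y∈)
        in least chip-y (subst (InSubtree i) (sym (unmoved py≢v)) y∈)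
             (≼c (exhausted Dv≤h chip-x (trans px par)) y≺x)

      -- By the fate of the new minimum: `b` is beaten by `a`; `a` takes one more step along `L`;
      -- `c` can be minimal only on entering the subtree, with `i` equal to `R v`.
      minimum-descends-after : ∀ {i} → 1 ≤ i → (∀ {w} → 1 ≤ w → L w ≢ i) →
        (2 ≤ i → Guarded i p D) → MinimumDescends i p D → MinimumDescends i q E
      minimum-descends-after {i} 1≤i not-L guard desc {s} min@(chip-s , s∈ , least) with moved s
      ... | is-b refl = ⊥-elim (least chip-a (a∈subtree (parent-subtree 1≤v (subst (InSubtree i) qb s∈))) a≺b)
      ... | is-a refl with subtree-L⁻ 1≤i 1≤v (subst (InSubtree i) qa s∈)
      ...   | inj₁ Lv≡i = ⊥-elim (not-L 1≤v Lv≡i)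
      ...   | inj₂ v∈ with desc (minimum-before 1≤i (subst (InSubtree i) (sym pa) v∈) min)
      ...     | (j , pa≡) , h≤D = (suc j , trans qa (cong L (trans (sym pa) pa≡))) , subst (λ z → height z ≤ E z) (sym qa) hL≤
        where
        h≤1+E : height v ≤ suc (E v)
        h≤1+E = subst (height v ≤_) D-at (subst (λ z → height z ≤ D z) pa h≤D)
        hL : height (L v) ≡ pred (height v)
        hL = trans (height-child (L≥2 1≤v)) (cong (pred ∘ height) (parent-L 1≤v))
        -- `D v` is positive and at least `height v`, so the inequality is strict even if `height v`
        -- is 0.
        hL<D : height (L v) < D (parent (L v))
        hL<D = subst₂ _<_ (sym hL) (sym (trans (cong D (parent-L 1≤v)) D-at)) (s≤s (pred-mono-≤ h≤1+E))
        Lv≢v : L v ≢ v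
        Lv≢v eq = <⇒≢ (parent< (L≥2 1≤v)) (trans (parent-L 1≤v) (sym eq))
        hL≤ : height (L v) ≤ E (L v)
        hL≤ = subst (height (L v) ≤_) (D-off Lv≢v) (child≥ (L≥2 1≤v) ≤-refl hL<D)
      minimum-descends-after {i} 1≤i not-L guard desc {s} min@(chip-s , s∈ , least)
          | is-c refl with subtree-R⁻ 1≤i 1≤v (subst (InSubtree i) qc s∈)
      ...   | inj₂ v∈ = ⊥-elim (least chip-a (a∈subtree v∈) (≺-trans a≺b b≺c))
      ...   | inj₁ refl = (0 , qc) , subst (λ z → height z ≤ E z) (sym qc)
                (subst (height (R v) ≤_) (D-off Rv≢v) (late-entry min (guard (R≥2 1≤v))))
        where
        Rv≢v : R v ≢ v
        Rv≢v eq = <⇒≢ (parent< (R≥2 1≤v)) (trans (parent-R 1≤v) (sym eq))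
      minimum-descends-after {i} 1≤i not-L guard desc {s} min@(chip-s , s∈ , least)
          | stays qs s≢a s≢b s≢c with desc (minimum-before 1≤i (subst (InSubtree i) qs s∈) min)
      ... | (j , ps) , h≤D = (j , trans qs ps) , subst (λ z → height z ≤ E z) (sym qs) h≤E
        where
        h≤E : height (p s) ≤ E (p s)
        h≤E with p s ≟ v
        ... | no ps≢v = subst (height (p s) ≤_) (D-off ps≢v) h≤D
        -- A chip left out by the firing of its node: then `D v` exceeds `height v`, and the bound
        -- survives the loss of one firing.
        ... | yes ps≡v with D v ≤? height v
        ...   | yes D≤h = ⊥-elim ([ s≢a , [ s≢b , s≢c ]′ ]′ (exhausted D≤h chip-s ps≡v))
        ...   | no D≰h = subst (λ z → height z ≤ E z) (sym ps≡v) (≤-pred (subst (height v <_) D-at (≰⇒> D≰h)))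

    module _
      (oriented : ∀ {p q : Config} {D E : ℕ → ℕ} → Firing _<_ (2 *_) (λ v → suc (2 * v)) p q D E → Firing _≺_ L R p q D E)
      {q : Config} (run : Reachable N initial q) (stable : Terminal N q) where

      private
        final : ∀ {v} → 1 ≤ v → #chips N q v ≡ filled v
        final = #chips-final run stable

      descends-along : ∀ {i} → 1 ≤ i → (∀ {w} → 1 ≤ w → L w ≢ i) → ∀ {p} (r : Reachable N p q) → Positive p →
        Interlocked (odometer r) → (2 ≤ i → Guarded i p (odometer r)) → MinimumDescends i p (odometer r) →
        MinimumDescends i q (λ _ → 0) × Positive q
      descends-along 1≤i not-L ε pos lock guard desc = desc , pos
      descends-along 1≤i not-L (s@(step v a b c _ _ _ _ pa _ _) ◅ r) pos lock guard desc =
        descends-along 1≤i not-L r (fire-positive a b c (subst (1 ≤_) pa (pos a)) pos) (interlocked-after F)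
          (λ 2≤i → guarded-after (oriented F) 2≤i (guard 2≤i))
          (minimum-descends-after (oriented F) 1≤i not-L guard desc)
        where
        F = firing s r pos final lock

      descends-finally : ∀ {i} → 1 ≤ i → (∀ {w} → 1 ≤ w → L w ≢ i) → MinimumDescends i q (λ _ → 0) × Positive q
      descends-finally {i} 1≤i not-L = descends-along 1≤i not-L run (λ _ → s≤s z≤n)
        (interlocked-target (odometer≡target run stable)) guard desc
        where
        height≤ : ∀ {v} → 1 ≤ v → height v ≤ odometer run v
        height≤ {v} 1≤v = subst (height v ≤_) (sym (odometer≡target run stable 1≤v)) (≤-firings (height v))
        guard : 2 ≤ i → Guarded i initial (odometer run)
        guard _ D<h = ⊥-elim (<⇒≱ D<h (height≤ 1≤i))
        desc : MinimumDescends i initial (odometer run)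
        -- All chips start at the root, so the subtree of `i` holds a chip only if `i` is the root.
        desc (_ , s∈ , _) = (0 , ≤-antisym 1≤i (subtree-≥ s∈)) , height≤ (s≤s z≤n)

      -- The induction hypothesis excludes earlier counterexamples, so a counterexample `y` is the
      -- minimum of the subtree. It then ends at the node of `x`, which holds only one chip.
      bottom-extreme-top : ∀ {i} → 1 ≤ i → (∀ {w} → 1 ≤ w → L w ≢ i) → ∀ {j} → j + depth i ≡ M → ∀ {x y} →
        Chip N x → Chip N y → q x ≡ descend j i → InSubtree i (q y) → ¬ (y ≺ x)
      bottom-extreme-top {i} 1≤i not-L {j} j+d {x} {y} chip-x chip-y qx =
        ≺-induction (λ y → InSubtree i (q y) → ¬ (y ≺ x)) extreme chip-y
        where
        pos = proj₂ (descends-finally 1≤i not-L)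

        occupied⇒depth≤ : ∀ {y} → Chip N y → depth (q y) ≤ M
        occupied⇒depth≤ {y} chip-y = ≮⇒≥ λ M<d →
          <⇒≱ (#chips-≥ N q (q y) ([] ∷ []) ((chip-y , refl) ∷ [])) (≤-reflexive (trans (final (pos y)) (filled-below M<d)))

        extreme : ∀ {y} → Chip N y → (∀ {z} → Chip N z → z ≺ y → InSubtree i (q z) → ¬ (z ≺ x)) →
          InSubtree i (q y) → ¬ (y ≺ x)
        extreme {y} chip-y rec y∈ y≺x = collide (proj₁ (descends-finally 1≤i not-L)
          (chip-y , y∈ , λ chip-z z∈ z≺y → rec chip-z z≺y z∈ (≺-trans z≺y y≺x)))
          where
          collide : ¬ ((∃ λ j′ → q y ≡ descend j′ i) × height (q y) ≤ 0)
          collide ((j′ , qy) , h≤0) = <⇒≱ two≤ (subst (_≤ 1) (sym (final (pos x))) (filled≤1 (q x)))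
            where
            -- Height 0 gives depth at least `M`, and occupied nodes have depth at most `M`; this
            -- fixes the number of steps.
            j′+d : j′ + depth i ≡ M
            j′+d = trans (sym (trans (cong depth qy) (depth-descend j′ 1≤i)))
              (≤-antisym (occupied⇒depth≤ chip-y) (m∸n≡0⇒m≤n (n≤0⇒n≡0 h≤0)))
            qy≡qx : q y ≡ q x
            qy≡qx = trans qy (trans (cong (λ z → descend z i) (+-cancelʳ-≡ (depth i) j′ j (trans j′+d (sym j+d)))) (sym qx))
            two≤ : 2 ≤ #chips N q (q x)
            two≤ = #chips-≥ N q (q x) (((λ y≡x → ≺-irrefl (subst (_≺ x) y≡x y≺x)) ∷ []) ∷ [] ∷ [])
              ((chip-y , qy≡qx) ∷ (chip-x , refl) ∷ [])

      -- If `i` is an `L`-child, the straight path of its parent runs through `i` to the same bottom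
      -- node, and the subtree of the parent contains that of `i`.
      bottom-extreme : ∀ {i} → 1 ≤ i → ∀ {j} → j + depth i ≡ M → ∀ {x y} →
        Chip N x → Chip N y → q x ≡ descend j i → InSubtree i (q y) → ¬ (y ≺ x)
      bottom-extreme = node-rec P root extend
        where
        P : ℕ → Set
        P i = ∀ {j} → j + depth i ≡ M → ∀ {x y} →
          Chip N x → Chip N y → q x ≡ descend j i → InSubtree i (q y) → ¬ (y ≺ x)
        root : P 1
        root = bottom-extreme-top (s≤s z≤n) (λ 1≤w eq → <⇒≢ (L≥2 1≤w) (sym eq))
        extend : ∀ {v} → 2 ≤ v → P (parent v) → P v
        extend {v} 2≤v ih {j} j+d {x} {y} chip-x chip-y qx y∈ with L-or-R 2≤v
        ... | inj₂ v≡R = bottom-extreme-top (<⇒≤ 2≤v) (λ _ Lw≡v → L≢R (trans Lw≡v v≡R)) j+d chip-x chip-y qx y∈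
        ... | inj₁ v≡L = ih {suc j}
          (trans (sym (+-suc j _)) (trans (cong (j +_) (sym (depth-parent 2≤v))) j+d))
          chip-x chip-y
          (trans qx (trans (cong (descend j) v≡L) (descend-L j (parent v))))
          (subtree-trans (parent-subtree (<⇒≤ 2≤v) here) y∈)

-- The two orientations

chip-induction-< : ∀ N (P : ℕ → Set) → (∀ {y} → Chip N y → (∀ {z} → Chip N z → z < y → P z) → P y) →
  ∀ {y} → Chip N y → P y
chip-induction-< N P extend {y} = <-rec (λ y → Chip N y → P y) (λ y rec chip-y → extend chip-y (λ chip-z z<y → rec z<y chip-z)) y

-- The bound on the labels makes the reversed order well-founded; `k` bounds the decreasing quantity
-- `N ∸ y`.
chip-induction-> : ∀ N (P : ℕ → Set) → (∀ {y} → Chip N y → (∀ {z} → Chip N z → z > y → P z) → P y) →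
  ∀ {y} → Chip N y → P y
chip-induction-> N P extend {y} chip = go N (m∸n≤m N y) chip
  where
  go : ∀ k {y} → N ∸ y ≤ k → Chip N y → P y
  go k {y} N∸y≤k chip-y = extend chip-y λ chip-z@(_ , z≤N) y<z → descend k (≤-trans (∸-monoʳ-< y<z z≤N) N∸y≤k) chip-z
    where
    descend : ∀ k {z} → N ∸ z < k → Chip N z → P z
    descend (suc k) (s≤s N∸z≤k) = go k N∸z≤k

module _ (M : ℕ) where
  open Tree M
  open Dynamics M

  module Leftmost = Oriented _<_ <-trans (<-irrefl refl) (chip-induction-< N) (2 *_) (λ v → suc (2 * v))
    left≥2 right≥2 parent-left parent-right (λ {v} {w} → even≢odd v w) left-or-right

  -- Reversing the order exchanges the least and greatest chips of a firing, and with them the two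
  -- children; minima for `_>_` are the largest labels.
  module Rightmost = Oriented _>_ (flip <-trans) (<-irrefl refl) (chip-induction-> N) (λ v → suc (2 * v)) (2 *_)
    right≥2 left≥2 parent-right parent-left (λ {v} {w} → even≢odd w v ∘ sym) (Sum.swap ∘ left-or-right)

  descend-left : ∀ j i → Leftmost.descend j i ≡ 2 ^ j * i
  descend-left zero i = sym (*-identityˡ i)
  descend-left (suc j) i = trans (cong (2 *_) (descend-left j i)) (sym (*-assoc 2 (2 ^ j) i))

  -- Taking the successor turns a step to the right child into doubling.
  descend-right : ∀ j i → suc (Rightmost.descend j i) ≡ 2 ^ j * (i + 1)
  descend-right zero i = trans (+-comm 1 i) (sym (*-identityˡ (i + 1)))
  descend-right (suc j) i = begin
    2 + 2 * Rightmost.descend j i       ≡⟨ *-suc 2 (Rightmost.descend j i) ⟨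
    2 * suc (Rightmost.descend j i)     ≡⟨ cong (2 *_) (descend-right j i) ⟩
    2 * (2 ^ j * (i + 1))               ≡⟨ *-assoc 2 (2 ^ j) (i + 1) ⟨
    2 ^ suc j * (i + 1)                 ∎
    where open ≡-Reasoning

depth-level : ∀ {k i} → 2 ^ k ≤ i → i < 2 ^ suc k → depth i ≡ k
depth-level {k} {i} 2^k≤i i<2^1+k = ≤-antisym (≤-pred (proj₂ (depth<⇔<2^ 1≤i) i<2^1+k))
  (≮⇒≥ λ d<k → <⇒≱ (proj₁ (depth<⇔<2^ 1≤i) d<k) 2^k≤i)
  where
  1≤i : 1 ≤ i
  1≤i = ≤-trans (^-monoʳ-≤ 2 (z≤n {k})) 2^k≤i

-- Chip counts and extreme chips by level

theorem1p3 : ∀ (n : ℕ) → 1 ≤ n → ∀ (p : Config) →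
    Reachable (2 ^ n ∸ 1) initial p → Terminal (2 ^ n ∸ 1) p →
    ((∀ v → 1 ≤ v → v ≤ 2 ^ n ∸ 1 → length (chipsAt (2 ^ n ∸ 1) p v) ≡ 1)
    × (∀ v → 2 ^ n ∸ 1 < v → length (chipsAt (2 ^ n ∸ 1) p v) ≡ 0))
    × (∀ (k i : ℕ) → 1 ≤ k → k ≤ n ∸ 1 → 2 ^ (k ∸ 1) ≤ i → i < 2 ^ k →
    (∀ x y → 1 ≤ x → x ≤ 2 ^ n ∸ 1 → 1 ≤ y → y ≤ 2 ^ n ∸ 1 →
    p x ≡ 2 ^ (n ∸ k) * i → InSubtree i (p y) → x ≤ y)
    × (∀ x y → 1 ≤ x → x ≤ 2 ^ n ∸ 1 → 1 ≤ y → y ≤ 2 ^ n ∸ 1 →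
    p x ≡ 2 ^ (n ∸ k) * (i + 1) ∸ 1 → InSubtree i (p y) → y ≤ x))
theorem1p3 (suc M) _ p run stable = (one-chip , no-chip) , extremes
  where
  open Tree M
  open Dynamics M

  one-chip : ∀ v → 1 ≤ v → v ≤ N → #chips N p v ≡ 1
  one-chip v 1≤v v≤N = trans (#chips-final run stable 1≤v) (filled-within (≤N⇒depth≤ 1≤v v≤N))

  no-chip : ∀ v → N < v → #chips N p v ≡ 0
  no-chip v N<v = trans (#chips-final run stable 1≤v) (filled-below (≰⇒> λ d≤M → <⇒≱ N<v (depth≤⇒≤N 1≤v d≤M)))
    where
    1≤v : 1 ≤ v
    1≤v = ≤-trans (s≤s z≤n) N<v

  extremes : ∀ k i → 1 ≤ k → k ≤ M → 2 ^ (k ∸ 1) ≤ i → i < 2 ^ k →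
    (∀ x y → 1 ≤ x → x ≤ N → 1 ≤ y → y ≤ N → p x ≡ 2 ^ (suc M ∸ k) * i → InSubtree i (p y) → x ≤ y)
    × (∀ x y → 1 ≤ x → x ≤ N → 1 ≤ y → y ≤ N → p x ≡ 2 ^ (suc M ∸ k) * (i + 1) ∸ 1 → InSubtree i (p y) → y ≤ x)
  extremes (suc k) i _ k<M 2^k≤i i<2^1+k = smallest , largest
    where
    1≤i : 1 ≤ i
    1≤i = ≤-trans (^-monoʳ-≤ 2 (z≤n {k})) 2^k≤i
    -- A node on level `suc k` has depth `k`, so `M ∸ k` steps down lead to the last filled level.
    bottom : M ∸ k + depth i ≡ M
    bottom = trans (cong (M ∸ k +_) (depth-level 2^k≤i i<2^1+k)) (m∸n+n≡m (<⇒≤ k<M))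
    smallest : ∀ x y → 1 ≤ x → x ≤ N → 1 ≤ y → y ≤ N → p x ≡ 2 ^ (M ∸ k) * i → InSubtree i (p y) → x ≤ y
    smallest x y 1≤x x≤N 1≤y y≤N px y∈ = ≮⇒≥ (Leftmost.bottom-extreme M id run stable 1≤i bottom
      (1≤x , x≤N) (1≤y , y≤N) (trans px (sym (descend-left M (M ∸ k) i))) y∈)
    largest : ∀ x y → 1 ≤ x → x ≤ N → 1 ≤ y → y ≤ N → p x ≡ 2 ^ (M ∸ k) * (i + 1) ∸ 1 → InSubtree i (p y) → y ≤ x
    largest x y 1≤x x≤N 1≤y y≤N px y∈ = ≮⇒≥ (Rightmost.bottom-extreme M reflect run stable 1≤i bottom
      (1≤x , x≤N) (1≤y , y≤N) (trans px (cong (_∸ 1) (sym (descend-right M (M ∸ k) i)))) y∈)
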